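{- Governed stuttering bisimilarity strictly refines winner equivalence: in every parity game, governed stuttering bisimilar vertices are won by the same player; and there is a parity game with vertices $v,w$ that are won by the same player but are not governed stuttering bisimilar.
   Context: A parity game is a tuple $(V,\to,\Omega,\mathcal P)$ where $V$ is a finite set of vertices, $\to\subseteq V\times V$ is total (every vertex has at least one successor), $\Omega:V\to\mathbb N$ is a priority function, and $\mathcal P:V\to\{\Diamond,\Box\}$ assigns each vertex to player even ($\Diamond$) or odd ($\Box$). Winning: a play from $v$ is an infinite path $v_0v_1\dots$ with $v_0=v$ and $v_j\to v_{j+1}$. If the lowest priority occurring infinitely often on the play is even, $\Diamond$ wins it, otherwise $\Box$ wins it. A strategy for player $i$ is a partial function $\sigma:V^*\to V$, defined only for finite paths ending in a vertex owned by $i$, and giving a successor of the last vertex; it allows a play $v_0v_1\dots$ iff for all $j$, if $\sigma(v_0\dots v_j)$ is defined then $v_{j+1}=\sigma(v_0\dots v_j)$. It is winning from $v$ iff $i$ wins every play from $v$ allowed by it. A vertex is won by $i$ iff $i$ has a winning strategy from it (parity games are determined: each vertex is won by exactly one player, who even has a memoryless winning strategy). Vertices are winner equivalent iff they are won by the same player. A memoryless strategy for player $i$ is given as a partial function $\sigma:V\to V$ defined only on vertices owned by $i$, with $v\to\sigma(v)$ whenever defined. It allows an infinite path $p=v_0v_1\dots$ iff $v_{j+1}=\sigma(v_j)$ whenever $\sigma(v_j)$ is defined. For $v\in V$, $U,T\subseteq V$: - $v\mapsto_{i,U}T$ iff there is a memoryless strategy $\sigma$ for $i$ such that every infinite path $p=v_0v_1\dots$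 with $v_0=v$ allowed by $\sigma$ has some $n$ with $v_n\in T$ and $v_j\in U$ for all $j<n$; - $v\mapsto_{i,U}$ iff there is a memoryless strategy $\sigma$ for $i$ such that every infinite path $v_0v_1\dots$ with $v_0=v$ allowed by $\sigma$ has $v_j\in U$ for all $j$. For an equivalence relation $R$ on $V$, $[v]_R$ is the class of $v$ and $V_{/R}$ the set of classes. An equivalence relation $R\subseteq V\times V$ is a governed stuttering bisimulation iff $v\,R\,w$ implies: (a) $\Omega(v)=\Omega(w)$; (b) for all $\mathcal C\in V_{/R}\setminus\{[v]_R\}$, if $v$ has a successor in $\mathcal C$ then $w\mapsto_{\mathcal P(v),[w]_R}\mathcal C$; (c) for each player $i\in\{\Diamond,\Box\}$, $v\mapsto_{i,[v]_R}$ implies $w\mapsto_{i,[w]_R}$. Vertices are governed stuttering bisimilar iff some governed stuttering bisimulation relates them. -}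

module Defs where

open import Data.Fin.Base using (Fin)
open import Data.List.Base using (List; applyUpTo; last)
open import Data.List.Relation.Unary.Linked using (Linked)
open import Data.Maybe.Base using (Maybe; just)
open import Data.Nat.Base using (ℕ; suc; _≤_; _<_)
open import Data.Nat.Divisibility using (_∣_)
open import Data.Nat.InfinitelyOften using (Inf)
open import Data.Product.Base using (Σ; ∃; _×_)
open import Level using (0ℓ)
open import Relation.Binary.Core using (Rel)
open import Relation.Binary.Definitions using (Decidable)
open import Relation.Binary.PropositionalEquality.Core using (_≡_)
open import Relation.Binary.Structures using (IsEquivalence)
open import Relation.Nullary.Negation.Core using (¬_)
open import Relation.Unary using (Pred; _∈_; _≐_)

data Player : Set where
  ◇ □ : Player

record ParityGame : Set₁ where
  infix 4 _⟶_ _⟶?_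
  field
    size  : ℕ
    _⟶_   : Rel (Fin size) 0ℓ
    -- A subset of the finite set V × V has decidable membership.
    _⟶?_  : Decidable _⟶_
    total : ∀ v → ∃ λ u → v ⟶ u
    Ω     : Fin size → ℕ
    𝒫     : Fin size → Player

  V : Set
  V = Fin size

module _ (G : ParityGame) where
  open ParityGame G

  IsInfinitePath : (ℕ → V) → Set
  IsInfinitePath p = ∀ j → p j ⟶ p (suc j)

  IsPlayFrom : V → (ℕ → V) → Set
  IsPlayFrom v p = p 0 ≡ v × IsInfinitePath p

  -- Inf means "not only finitely often": infinitely many occurrences cannot
  -- be exhibited effectively for an arbitrary sequence p : ℕ → V.
  OccursInfinitelyOften : (ℕ → V) → ℕ → Set
  OccursInfinitelyOften p k = Inf (λ j → Ω (p j) ≡ k)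

  IsLowestInfinitelyOften : (ℕ → V) → ℕ → Set
  IsLowestInfinitelyOften p k =
    OccursInfinitelyOften p k × (∀ l → OccursInfinitelyOften p l → k ≤ l)

  -- As V is finite, the lowest priority occurring infinitely often exists
  -- (classically) and is unique; it is referred to by ∀ rather than ∃ since it
  -- cannot be computed from p.
  LowestIsEven : (ℕ → V) → Set
  LowestIsEven p = ∀ k → IsLowestInfinitelyOften p k → 2 ∣ k

  WinsPlay : Player → (ℕ → V) → Set
  WinsPlay ◇ p = LowestIsEven p
  WinsPlay □ p = ¬ LowestIsEven p

  -- A partial function V* ⇀ V is a function into Maybe V.
  record Strategy (i : Player) : Set where
    field
      move  : List V → Maybe V
      valid : ∀ {h u} → move h ≡ just u →
              Linked _⟶_ h × ∃ λ x → last h ≡ just x × 𝒫 x ≡ i × x ⟶ u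

  -- applyUpTo p (suc j) is the list p 0, …, p j.
  Allows : ∀ {i} → Strategy i → (ℕ → V) → Set
  Allows σ p = ∀ j {u} →
    Strategy.move σ (applyUpTo p (suc j)) ≡ just u → p (suc j) ≡ u

  IsWinningFrom : ∀ {i} → V → Strategy i → Set
  IsWinningFrom {i} v σ = ∀ p → IsPlayFrom v p → Allows σ p → WinsPlay i p

  WonBy : Player → V → Set
  WonBy i v = Σ (Strategy i) (IsWinningFrom v)

  WinnerEquivalent : V → V → Set
  WinnerEquivalent v w = ∃ λ i → WonBy i v × WonBy i w

  record MemorylessStrategy (i : Player) : Set where
    field
      move  : V → Maybe V
      valid : ∀ {v u} → move v ≡ just u → 𝒫 v ≡ i × v ⟶ u

  AllowsMemoryless : ∀ {i} → MemorylessStrategy i → (ℕ → V) → Set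
  AllowsMemoryless σ p = ∀ j {u} →
    MemorylessStrategy.move σ (p j) ≡ just u → p (suc j) ≡ u

  -- v ↦⟨ i , U ⟩ T : player i can force the play from v into T through U.
  _↦⟨_,_⟩_ : V → Player → Pred V 0ℓ → Pred V 0ℓ → Set
  v ↦⟨ i , U ⟩ T = Σ (MemorylessStrategy i) λ σ →
    ∀ p → IsPlayFrom v p → AllowsMemoryless σ p →
    ∃ λ n → p n ∈ T × (∀ j → j < n → p j ∈ U)

  -- v ↦⟨ i , U ⟩ : player i can keep the play from v inside U forever.
  _↦⟨_,_⟩ : V → Player → Pred V 0ℓ → Set
  v ↦⟨ i , U ⟩ = Σ (MemorylessStrategy i) λ σ →
    ∀ p → IsPlayFrom v p → AllowsMemoryless σ p → ∀ j → p j ∈ U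

  [_]_ : V → Rel V 0ℓ → Pred V 0ℓ
  [ v ] R = R v

  -- The classes of R are the sets [ c ] R, so quantifying over representatives
  -- c quantifies over V/R.
  record IsGovernedStutteringBisimulation (R : Rel V 0ℓ) : Set where
    field
      isEquivalence : IsEquivalence R
      priority : ∀ {v w} → R v w → Ω v ≡ Ω w
      step     : ∀ {v w} → R v w →
                 ∀ c → ¬ (([ c ] R) ≐ ([ v ] R)) →
                 (∃ λ u → v ⟶ u × u ∈ [ c ] R) →
                 w ↦⟨ 𝒫 v , [ w ] R ⟩ ([ c ] R)
      diverge  : ∀ {v w} → R v w →
                 ∀ i → v ↦⟨ i , [ v ] R ⟩ → w ↦⟨ i , [ w ] R ⟩

  GovernedStutteringBisimilar : V → V → Set₁
  GovernedStutteringBisimilar v w =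
    Σ (Rel V 0ℓ) λ R → IsGovernedStutteringBisimulation R × R v w

{-# OPTIONS --safe #-}
module Submission where

-- Parity games are memorylessly determined, so it suffices that no class of a
-- governed stuttering bisimulation contains vertices v and w won by different
-- players. If it did, let both players follow their winning strategies, one in
-- the play from v and the other in the play from w. While the class is mixed,
-- the two plays can be steered, by transferring moves from one to the other, to
-- leave it for the same class, which is then mixed again: a player favoured by
-- the priority of the class cannot confine the opponent's winning play to it,
-- hence by the divergence condition neither play is confined. Repeating this
-- gives two plays with the same priorities up to stuttering but different winners.
--
-- The conclusion being negative, membership in the bisimulation and the existence
-- of the next mixed pair may be decided classically: V is finite, so double
-- negation commutes with quantification over V.

open import Defs
open import Data.Bool.Base using (if_then_else_)
open import Data.Empty using (⊥)
open import Data.Fin.Base using (Fin; zero; suc; toℕ)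
open import Data.Fin.Properties using (_≟_; any?; all?; sequence)
open import Data.Fin.Subset
  using (Subset; _∈_; _∉_; _⊆_; _⊂_; _∪_; _∩_; ∁; ⁅_⁆; ⊤)
  renaming (⊥ to ∅)
open import Data.Fin.Subset.Induction
  using (Acc; acc; ⊂-wellFounded; ⊃-wellFounded)
open import Data.Fin.Subset.Properties
  using (_∈?_; ∉⊥; ∈⊤; nonempty?; x∈⁅x⁆; x∈⁅y⁆⇒x≡y; x∈p∩q⁺; x∈p∩q⁻; p∩q⊆p;
         x∈p∪q⁺; x∈p∪q⁻; p⊆p∪q; q⊆p∪q; x∈∁p⇒x∉p; x∉p⇒x∈∁p)
open import Data.List.Base using (List; applyUpTo; last)
open import Data.List.Relation.Unary.Linked using (Linked; linked?)
open import Data.List.Relation.Unary.Linked.Properties using (applyUpTo⁺₂)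
open import Data.Maybe.Base using (Maybe; just; nothing; fromMaybe)
open import Data.Nat.Base using (ℕ; zero; suc; _+_; _*_; _≤_; _<_; z≤n; s≤s)
open import Data.Nat.Divisibility using (_∣_; _∣?_; m∣m*n)
open import Data.Nat.GeneralisedArithmetic using (fold)
open import Data.Nat.Induction using (<-wellFounded)
open import Data.Nat.InfinitelyOften using (Inf) renaming (map to Inf-map; Fin to Finitely)
open import Data.Nat.Properties
  using (≤-refl; ≤-reflexive; ≤-trans; ≤-antisym; <⇒≤; <⇒≱; ≮⇒≥; ≰⇒>;
         _≤?_; _<?_; m≤m+n; m≤n+m; n≤1+n; m∸n+n≡m; <-cmp)
open import Data.Product.Base using (Σ; ∃; _×_; _,_; proj₁; proj₂)
open import Data.Sum.Base using (_⊎_; inj₁; inj₂; [_,_]′)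
open import Effect.Monad using (RawMonad)
open import Function.Base using (_∘_; id)
open import Level using (0ℓ)
open import Relation.Binary.Construct.Closure.Transitive
  using (TransClosure; [_]; _∷_; _∷ʳ_)
open import Relation.Binary.Core using (Rel)
open import Relation.Binary.Definitions using (tri<; tri≈; tri>)
open import Relation.Binary.PropositionalEquality
  using (_≡_; _≢_; refl; sym; trans; cong; subst)
open import Relation.Binary.Structures using (IsEquivalence)
open import Relation.Nullary.Decidable
  using (Dec; yes; no; does; ¬?; _×-dec_; _⊎-dec_; _→-dec_; decidable-stable;
         ¬¬-excluded-middle)
open import Relation.Nullary.Negation using (¬¬-Monad)
open import Relation.Nullary.Negation.Core using (¬_; contradiction)
open import Relation.Unary using (Pred; Decidable)

-- Sequences

-- A reindexing that absorbs stuttering: a sequence `p` is matched with `q ∘ f`. As `f 0` is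
-- arbitrary, dropping a prefix is an instance too.
record Slow (f : ℕ → ℕ) : Set where
  field
    step      : ∀ j → f (suc j) ≡ f j ⊎ f (suc j) ≡ suc (f j)
    unbounded : ∀ n → ∃ λ j → n ≤ f j

  step-≤ : ∀ j → f j ≤ f (suc j)
  step-≤ j with step j
  ... | inj₁ e = ≤-reflexive (sym e)
  ... | inj₂ e = ≤-trans (n≤1+n _) (≤-reflexive (sym e))

  mono-+ : ∀ {i} d → f i ≤ f (d + i)
  mono-+ zero    = ≤-refl
  mono-+ (suc d) = ≤-trans (mono-+ d) (step-≤ _)

  mono : ∀ {i j} → i ≤ j → f i ≤ f j
  mono {i} {j} i≤j = subst (λ k → f i ≤ f k) (m∸n+n≡m i≤j) (mono-+ _)

  -- A discrete intermediate value argument: searching down from an index where `f` is at least `n`,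
  -- no step of size at most one can jump over `n`.
  hits : ∀ n → f 0 ≤ n → ∃ λ j → f j ≡ n
  hits n f0≤n = search (proj₁ (unbounded n)) (proj₂ (unbounded n))
    where
    search : ∀ j → n ≤ f j → ∃ λ k → f k ≡ n
    search zero    n≤f0 = 0 , ≤-antisym f0≤n n≤f0
    search (suc j) n≤f with n ≤? f j
    ... | yes n≤fj = search j n≤fj
    ... | no  n≰fj with step j
    ...   | inj₁ e = contradiction (≤-trans n≤f (≤-reflexive e)) n≰fj
    ...   | inj₂ e = suc j , ≤-antisym (≤-trans (≤-reflexive e) (≰⇒> n≰fj)) n≤f

slow-id : Slow id
slow-id = record { step = λ _ → inj₂ refl ; unbounded = λ n → n , ≤-refl }

slow-shift : ∀ m → Slow (_+ m)
slow-shift m = record { step = λ _ → inj₂ refl ; unbounded = λ n → n , m≤m+n n m }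

module _ {f : ℕ → ℕ} (slow : Slow f) {P Q : Pred ℕ 0ℓ} where
  open Slow slow

  Finitely-∘⁺ : (∀ {j} → P j → Q (f j)) → Finitely Q → Finitely P
  Finitely-∘⁺ P⇒Q (n , none) =
    let i , n≤fi = unbounded n
    in i , λ j i≤j → none (f j) (≤-trans n≤fi (mono i≤j)) ∘ P⇒Q

  Finitely-∘⁻ : (∀ {j} → Q (f j) → P j) → Finitely P → Finitely Q
  -- With the bound one above `f i`, monotonicity places every index mapped to `n` at `i` or later.
  Finitely-∘⁻ Q⇒P (i , none) = suc (f i) , λ n fi<n Qn →
    let j , fj≡n = hits n (≤-trans (mono z≤n) (<⇒≤ fi<n))
        i≤j = ≮⇒≥ λ j<i →
          <⇒≱ fi<n (≤-trans (≤-reflexive (sym fj≡n)) (mono (<⇒≤ j<i)))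
    in none j i≤j (Q⇒P (subst Q (sym fj≡n) Qn))

first-exit : ∀ {P : Pred ℕ 0ℓ} → Decidable P → P 0 → ∀ n → ¬ P n →
             ∃ λ m → (∀ k → k ≤ m → P k) × ¬ P (suc m)
first-exit P? P0 zero    ¬P = contradiction P0 ¬P
first-exit P? P0 (suc n) ¬P with P? 1
... | no ¬P1 = 0 , (λ { _ z≤n → P0 }) , ¬P1
... | yes P1 =
  let m , below , ¬Pm = first-exit (P? ∘ suc) P1 n ¬P
  in suc m , (λ { zero _ → P0 ; (suc k) (s≤s k≤m) → below k k≤m }) , ¬Pm

¬¬-Π : ∀ {n} {P : Pred (Fin n) 0ℓ} → (∀ v → ¬ ¬ P v) → ¬ ¬ (∀ v → P v)
¬¬-Π = sequence (RawMonad.rawApplicative ¬¬-Monad)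

¬¬-→ : {A B : Set} → (A → ¬ ¬ B) → ¬ ¬ (A → B)
¬¬-→ f ¬g = ¬g λ a → contradiction (λ b → ¬g λ _ → b) (f a)

-- Players

opp : Player → Player
opp ◇ = □
opp □ = ◇

_≟ᴾ_ : (i j : Player) → Dec (i ≡ j)
◇ ≟ᴾ ◇ = yes refl
◇ ≟ᴾ □ = no λ ()
□ ≟ᴾ ◇ = no λ ()
□ ≟ᴾ □ = yes refl

opp-involutive : ∀ i → opp (opp i) ≡ i
opp-involutive ◇ = refl
opp-involutive □ = refl

≢opp : ∀ i → i ≢ opp i
≢opp ◇ ()
≢opp □ ()

≢⇒≡opp : ∀ {i j} → j ≢ i → j ≡ opp i
≢⇒≡opp {◇} {◇} j≢i = contradiction refl j≢i
≢⇒≡opp {◇} {□} j≢i = refl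
≢⇒≡opp {□} {◇} j≢i = refl
≢⇒≡opp {□} {□} j≢i = contradiction refl j≢i

Favours : Player → ℕ → Set
Favours ◇ d = 2 ∣ d
Favours □ d = ¬ 2 ∣ d

favoured : ∀ d → ∃ λ i → Favours i d
favoured d with 2 ∣? d
... | yes 2∣d = ◇ , 2∣d
... | no  2∤d = □ , 2∤d

module _ (G : ParityGame) where
  open ParityGame G

  -- Winning conditions

  -- Evenness is decidable and the other condition is a negation. Stability admits case distinctions
  -- on the undecidable behaviour of an infinite play.
  WinsPlay-stable : ∀ i {p} → ¬ ¬ WinsPlay G i p → WinsPlay G i p
  WinsPlay-stable ◇ ¬¬w k low = decidable-stable (2 ∣? k) λ 2∤k → ¬¬w λ w → 2∤k (w k low)
  WinsPlay-stable □ ¬¬w w = ¬¬w λ ¬w → ¬w w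

  not-both-win : ∀ i {p} → WinsPlay G i p → ¬ WinsPlay G (opp i) p
  not-both-win ◇ w ¬w = ¬w w
  not-both-win □ ¬w w = ¬w w

  module _ {f} (slow : Slow f) {p q : ℕ → V} (same : ∀ j → Ω (p j) ≡ Ω (q (f j))) where

    private
      to : ∀ {k} → OccursInfinitelyOften G p k → OccursInfinitelyOften G q k
      to inf = inf ∘ Finitely-∘⁺ slow (λ {j} → trans (sym (same j)))

      from : ∀ {k} → OccursInfinitelyOften G q k → OccursInfinitelyOften G p k
      from inf = inf ∘ Finitely-∘⁻ slow (λ {j} → trans (same j))

      LowestIsEven⁺ : LowestIsEven G p → LowestIsEven G q
      LowestIsEven⁺ w k (inf , low) = w k (from inf , λ l → low l ∘ to)

      LowestIsEven⁻ : LowestIsEven G q → LowestIsEven G p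
      LowestIsEven⁻ w k (inf , low) = w k (to inf , λ l → low l ∘ from)

    -- Occurring infinitely often transfers in both directions, so the two sequences have the same
    -- lowest recurring priority.
    WinsPlay-slow : ∀ i → WinsPlay G i p → WinsPlay G i q
    WinsPlay-slow ◇ = LowestIsEven⁺
    WinsPlay-slow □ w = w ∘ LowestIsEven⁻

  shift : ℕ → (ℕ → V) → ℕ → V
  shift m p k = p (k + m)

  WinsPlay-shift : ∀ i m {p} → WinsPlay G i (shift m p) → WinsPlay G i p
  WinsPlay-shift i m = WinsPlay-slow (slow-shift m) (λ _ → refl) i

  recurring-minimum-wins : ∀ i {d p} → Favours i d → (∀ k → d ≤ Ω (p k)) →
                           OccursInfinitelyOften G p d → WinsPlay G i p
  recurring-minimum-wins i {d} {p} fav d≤ inf = by i fav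
    where
    lowest : IsLowestInfinitelyOften G p d
    lowest = inf , λ l inf-l → decidable-stable (d ≤? l) λ d≰l →
      inf-l (0 , λ { j _ refl → d≰l (d≤ j) })

    by : ∀ i → Favours i d → WinsPlay G i p
    by ◇ 2∣d k (inf-k , low-k) =
      subst (2 ∣_) (≤-antisym (proj₂ lowest k inf-k) (low-k d inf)) 2∣d
    by □ 2∤d w = 2∤d (w d lowest)

  -- Choice functions

  -- A total move function on the vertices of both players, of which `Follows i` reads only those of
  -- `i`. Choices of two players can thus be spliced into one function that determines a play.
  record Choice : Set where
    field
      at   : V → V
      edge : ∀ v → v ⟶ at v
  open Choice

  default : Choice
  default = record { at = proj₁ ∘ total ; edge = proj₂ ∘ total }

  module _ {P : Pred V 0ℓ} (P? : Decidable P) (f g : Choice) where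

    splice : Choice
    splice .at v = if does (P? v) then at f v else at g v
    splice .edge v with P? v
    ... | yes _ = edge f v
    ... | no  _ = edge g v

    splice-yes : ∀ {v} → P v → at splice v ≡ at f v
    splice-yes {v} Pv with P? v
    ... | yes _  = refl
    ... | no ¬Pv = contradiction Pv ¬Pv

    splice-no : ∀ {v} → ¬ P v → at splice v ≡ at g v
    splice-no {v} ¬Pv with P? v
    ... | yes Pv = contradiction Pv ¬Pv
    ... | no _   = refl

  redirect : ∀ {v u} → v ⟶ u → Choice → Choice
  redirect {v} {u} e f .at w with w ≟ v
  ... | yes _ = u
  ... | no  _ = at f w
  redirect {v} {u} e f .edge w with w ≟ v
  ... | yes refl = e
  ... | no  _    = edge f w

  redirect-here : ∀ {v u} (e : v ⟶ u) f → at (redirect e f) v ≡ u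
  redirect-here {v} e f with v ≟ v
  ... | yes _  = refl
  ... | no v≢v = contradiction refl v≢v

  redirect-there : ∀ {v u w} (e : v ⟶ u) f → w ≢ v → at (redirect e f) w ≡ at f w
  redirect-there {v} {w = w} e f w≢v with w ≟ v
  ... | yes w≡v = contradiction w≡v w≢v
  ... | no _    = refl

  Follows : Player → Choice → Pred (ℕ → V) 0ℓ
  Follows i f p = ∀ k → 𝒫 (p k) ≡ i → p (suc k) ≡ at f (p k)

  -- Attractors

  Subgame : Pred (Subset size) 0ℓ
  Subgame X = ∀ {v} → v ∈ X → ∃ λ u → v ⟶ u × u ∈ X

  module _ (i : Player) (X A : Subset size) where

    -- The loop invariant of the attractor computation. `reach` demands obedience only inside `B`
    -- and off `A`, so it survives splicing with other choices elsewhere.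
    record Forcing (B : Subset size) (f : Choice) : Set where
      field
        within : B ⊆ X
        target : A ⊆ B
        own    : ∀ {v} → v ∈ B → v ∉ A → 𝒫 v ≡ i → at f v ∈ B
        other  : ∀ {v u} → v ∈ B → v ∉ A → 𝒫 v ≡ opp i → v ⟶ u → u ∈ X → u ∈ B
        reach  : ∀ {p} → IsInfinitePath G p → (∀ k → p k ∈ X) →
                 (∀ k → p k ∈ B → p k ∉ A → 𝒫 (p k) ≡ i → p (suc k) ≡ at f (p k)) →
                 p 0 ∈ B → ∃ λ m → p m ∈ A

    record Attractor : Set where
      field
        set           : Subset size
        choice        : Choice
        forcing       : Forcing set choice
        maximal-own   : ∀ {v u} → v ∈ X → v ∉ set → 𝒫 v ≡ i → v ⟶ u → u ∉ set
        maximal-other : ∀ {v} → v ∈ X → v ∉ set → 𝒫 v ≡ opp i →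
                        ∃ λ u → v ⟶ u × u ∈ X × u ∉ set
      open Forcing forcing public

    Attractable : Subset size → Pred V 0ℓ
    Attractable B x =
      (𝒫 x ≡ i × ∃ λ u → x ⟶ u × u ∈ B) ⊎
      (𝒫 x ≡ opp i × ∀ u → x ⟶ u → u ∈ X → u ∈ B)

    attractable? : ∀ B → Decidable (Attractable B)
    attractable? B x =
      (𝒫 x ≟ᴾ i ×-dec any? λ u → (x ⟶? u) ×-dec (u ∈? B)) ⊎-dec
      (𝒫 x ≟ᴾ opp i ×-dec
        all? λ u → (x ⟶? u) →-dec ((u ∈? X) →-dec (u ∈? B)))

    -- Since `x` is new, redirecting its move leaves the choice on `B` intact; a play from `x`
    -- enters `B` with its first move and is then covered by the old `reach`.
    forcing-extend : ∀ {B f x} → Forcing B f → x ∈ X → x ∉ B → Attractable B x →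
                     ∃ (Forcing (B ∪ ⁅ x ⁆))
    forcing-extend {B} {f} {x} F x∈X x∉B = λ where
        (inj₁ (x-own , u , x⟶u , u∈B)) →
          extend (redirect x⟶u f)
            (λ v∈B → redirect-there x⟶u f λ { refl → x∉B v∈B })
            (λ _ → subst (_∈ B) (sym (redirect-here x⟶u f)) u∈B)
            (λ x-other → contradiction (trans (sym x-own) x-other) (≢opp i))
        (inj₂ (x-other , all∈B)) →
          extend f (λ _ → refl)
            (λ x-own → contradiction (trans (sym x-own) x-other) (≢opp i))
            (λ _ → all∈B _)
      where
      open Forcing F
      B′ = B ∪ ⁅ x ⁆

      widen : ∀ {v} → v ∈ B → v ∈ B′
      widen v∈B = x∈p∪q⁺ (inj₁ v∈B)

      split : ∀ {v} → v ∈ B′ → v ∈ B ⊎ v ≡ x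
      split v∈B′ with x∈p∪q⁻ B ⁅ x ⁆ v∈B′
      ... | inj₁ v∈B = inj₁ v∈B
      ... | inj₂ v∈x = inj₂ (x∈⁅y⁆⇒x≡y x v∈x)

      extend : ∀ g → (∀ {v} → v ∈ B → at g v ≡ at f v) →
               (𝒫 x ≡ i → at g x ∈ B) →
               (∀ {u} → 𝒫 x ≡ opp i → x ⟶ u → u ∈ X → u ∈ B) → ∃ (Forcing B′)
      extend g agree x-own x-other = g , record
        { within = λ v∈B′ → [ within , (λ { refl → x∈X }) ]′ (split v∈B′)
        ; target = widen ∘ target
        ; own    = λ v∈B′ v∉A owned → widen (
            [ (λ v∈B → subst (_∈ B) (sym (agree v∈B)) (own v∈B v∉A owned))
            , (λ { refl → x-own owned }) ]′ (split v∈B′))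
        ; other  = λ v∈B′ v∉A owned v⟶u u∈X → widen (
            [ (λ v∈B → other v∈B v∉A owned v⟶u u∈X)
            , (λ { refl → x-other owned v⟶u u∈X }) ]′ (split v∈B′))
        ; reach  = reach′
        }
        where
        reach′ : ∀ {p} → IsInfinitePath G p → (∀ k → p k ∈ X) →
                 (∀ k → p k ∈ B′ → p k ∉ A → 𝒫 (p k) ≡ i → p (suc k) ≡ at g (p k)) →
                 p 0 ∈ B′ → ∃ λ m → p m ∈ A
        reach′ {p} path inX follows p0∈B′ with split p0∈B′
        ... | inj₁ p0∈B = reach path inX
                (λ k pk∈B pk∉A owned →
                  trans (follows k (widen pk∈B) pk∉A owned) (agree pk∈B))
                p0∈B
        ... | inj₂ p0≡x =
          let m , pm∈A = reach {p ∘ suc} (path ∘ suc) (inX ∘ suc)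
                (λ k pk∈B pk∉A owned →
                  trans (follows (suc k) (widen pk∈B) pk∉A owned) (agree pk∈B))
                p1∈B
          in suc m , pm∈A
          where
          x∉A : p 0 ∉ A
          x∉A p0∈A = x∉B (subst (_∈ B) p0≡x (target p0∈A))

          p1∈B : p 1 ∈ B
          p1∈B with 𝒫 (p 0) ≟ᴾ i
          ... | yes owned =
            subst (_∈ B)
              (sym (trans (follows 0 p0∈B′ x∉A owned) (cong (at g) p0≡x)))
              (x-own (trans (cong 𝒫 (sym p0≡x)) owned))
          ... | no ¬owned =
            x-other (trans (cong 𝒫 (sym p0≡x)) (≢⇒≡opp ¬owned))
              (subst (_⟶ p 1) p0≡x (path 0)) (inX 1)

    abstract
      -- Vertices are added one at a time, which stops because `V` is finite; then the failure of
      -- `Attractable` outside the set yields both maximality fields.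
      attractor : A ⊆ X → Attractor
      attractor A⊆X = grow (⊃-wellFounded A) {default} record
        { within = A⊆X
        ; target = id
        ; own    = λ v∈A v∉A → contradiction v∈A v∉A
        ; other  = λ v∈A v∉A → contradiction v∈A v∉A
        ; reach  = λ _ _ _ p0∈A → 0 , p0∈A
        }
        where
        grow : ∀ {B} → Acc (λ p q → q ⊂ p) B → ∀ {f} → Forcing B f → Attractor
        grow {B} (acc rec) {f} F
          with any? (λ x → (x ∈? X) ×-dec (¬? (x ∈? B) ×-dec attractable? B x))
        ... | yes (x , x∈X , x∉B , attr) =
          grow (rec (p⊆p∪q ⁅ x ⁆ , x , q⊆p∪q B ⁅ x ⁆ (x∈⁅x⁆ x) , x∉B))
               (proj₂ (forcing-extend F x∈X x∉B attr))
        ... | no none = record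
          { set           = B
          ; choice        = f
          ; forcing       = F
          ; maximal-own   = λ {v} {u} v∈X v∉B owned v⟶u u∈B →
              none (v , v∈X , v∉B , inj₁ (owned , u , v⟶u , u∈B))
          ; maximal-other = λ {v} → escape v
          }
          where
          escape : ∀ v → v ∈ X → v ∉ B → 𝒫 v ≡ opp i → ∃ λ u → v ⟶ u × u ∈ X × u ∉ B
          escape v v∈X v∉B owned
            with any? (λ u → (v ⟶? u) ×-dec ((u ∈? X) ×-dec ¬? (u ∈? B)))
          ... | yes found = found
          ... | no  stuck = contradiction
            (v , v∈X , v∉B , inj₂ (owned , λ u v⟶u u∈X →
              decidable-stable (u ∈? B) λ u∉B → stuck (u , v⟶u , u∈X , u∉B)))
            none

  -- Memoryless determinacy

  ─⁺ : ∀ {X B : Subset size} {v} → v ∈ X → v ∉ B → v ∈ X ∩ ∁ B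
  ─⁺ v∈X v∉B = x∈p∩q⁺ (v∈X , x∉p⇒x∈∁p v∉B)

  ─⁻ : ∀ (X B : Subset size) {v} → v ∈ X ∩ ∁ B → v ∈ X × v ∉ B
  ─⁻ X B v∈ = let v∈X , v∈∁B = x∈p∩q⁻ X (∁ B) v∈ in v∈X , x∈∁p⇒x∉p v∈∁B

  -- At a vertex of `i` every successor avoids the attractor, so the one in `X` serves; at an
  -- opponent's vertex maximality provides an escape.
  attractor-complement : ∀ {i X A} → Subgame X → (B : Attractor i X A) →
                         Subgame (X ∩ ∁ (Attractor.set B))
  attractor-complement {i} {X} sub B {v} v∈ with ─⁻ X (Attractor.set B) v∈ | 𝒫 v ≟ᴾ i
  ... | v∈X , v∉B | yes owned =
    let u , v⟶u , u∈X = sub v∈X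
    in u , v⟶u , ─⁺ u∈X (Attractor.maximal-own B v∈X v∉B owned v⟶u)
  ... | v∈X , v∉B | no ¬owned =
    let u , v⟶u , u∈X , u∉B = Attractor.maximal-other B v∈X v∉B (≢⇒≡opp ¬owned)
    in u , v⟶u , ─⁺ u∈X u∉B

  -- A trap for the opponent of `i` relative to the subgame `X`, with a memoryless strategy winning
  -- every play that remains in it.
  record Dominion (i : Player) (X : Subset size) : Set where
    field
      set    : Subset size
      choice : Choice
      within : set ⊆ X
      own    : ∀ {v} → v ∈ set → 𝒫 v ≡ i → at choice v ∈ set
      other  : ∀ {v u} → v ∈ set → 𝒫 v ≡ opp i → v ⟶ u → u ∈ X → u ∈ set
      wins   : ∀ {p} → IsInfinitePath G p → (∀ k → p k ∈ set) →
               Follows i choice p → WinsPlay G i p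

    FollowsInside : Pred (ℕ → V) 0ℓ
    FollowsInside p = ∀ k → p k ∈ set → 𝒫 (p k) ≡ i → p (suc k) ≡ at choice (p k)

    stays : ∀ {p} → IsInfinitePath G p → (∀ k → p k ∈ X) → FollowsInside p →
            p 0 ∈ set → ∀ k → p k ∈ set
    stays path inX follows p0∈ zero    = p0∈
    stays {p} path inX follows p0∈ (suc k)
      with pk∈ ← stays path inX follows p0∈ k | 𝒫 (p k) ≟ᴾ i
    ... | yes owned = subst (_∈ set) (sym (follows k pk∈ owned)) (own pk∈ owned)
    ... | no ¬owned = other pk∈ (≢⇒≡opp ¬owned) (path k) (inX (suc k))

    wins-once-inside : ∀ {p} → IsInfinitePath G p → (∀ k → p k ∈ X) →
                       FollowsInside p → ∀ m → p m ∈ set → WinsPlay G i p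
    wins-once-inside {p} path inX follows m pm∈ =
      WinsPlay-shift i m (wins (λ k → path (k + m)) inside (λ k → follows (k + m) (inside k)))
      where
      inside : ∀ k → p (k + m) ∈ set
      inside = stays (λ k → path (k + m)) (λ k → inX (k + m)) (λ k → follows (k + m)) pm∈

  ∅-dominion : ∀ i X → Dominion i X
  ∅-dominion i X = record
    { set    = ∅
    ; choice = default
    ; within = λ v∈∅ → contradiction v∈∅ ∉⊥
    ; own    = λ v∈∅ → contradiction v∈∅ ∉⊥
    ; other  = λ v∈∅ → contradiction v∈∅ ∉⊥
    ; wins   = λ _ in∅ → contradiction (in∅ 0) ∉⊥
    }

  -- The only new moves of the opponent would lead into `B`, and outside an attractor its owner has
  -- no move into it. The equation on players serves both instances, as `opp (opp j)` does not
  -- reduce for a variable `j`.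
  dominion-lift : ∀ {i j X A} → opp j ≡ i → (B : Attractor i X A) →
                  Dominion j (X ∩ ∁ (Attractor.set B)) → Dominion j X
  dominion-lift {X = X} opp-j≡i B D = record
    { set    = set
    ; choice = choice
    ; within = λ v∈D → proj₁ (─⁻ X B.set (within v∈D))
    ; own    = own
    ; other  = λ v∈D owned v⟶u u∈X →
        let v∈X , v∉B = ─⁻ X B.set (within v∈D)
        in other v∈D owned v⟶u (─⁺ u∈X (B.maximal-own v∈X v∉B (trans owned opp-j≡i) v⟶u))
    ; wins   = wins
    }
    where
    open Dominion D
    module B = Attractor B

  -- The attractor strategy leads into the dominion, whose strategy then takes over; winning ignores
  -- the finite prefix.
  dominion-attractor : ∀ {i X} (D : Dominion i X) →
                       Attractor i X (Dominion.set D) → Dominion i X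
  dominion-attractor {i} {X} D B = record
    { set    = B.set
    ; choice = f
    ; within = B.within
    ; own    = own′
    ; other  = other′
    ; wins   = wins′
    }
    where
    module D = Dominion D
    module B = Attractor B

    f : Choice
    f = splice (_∈? D.set) D.choice B.choice

    own′ : ∀ {v} → v ∈ B.set → 𝒫 v ≡ i → at f v ∈ B.set
    own′ {v} v∈B owned with v ∈? D.set
    ... | yes v∈D = B.target (D.own v∈D owned)
    ... | no  v∉D = B.own v∈B v∉D owned

    other′ : ∀ {v u} → v ∈ B.set → 𝒫 v ≡ opp i → v ⟶ u → u ∈ X → u ∈ B.set
    other′ {v} v∈B owned v⟶u u∈X with v ∈? D.set
    ... | yes v∈D = B.target (D.other v∈D owned v⟶u u∈X)
    ... | no  v∉D = B.other v∈B v∉D owned v⟶u u∈X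

    wins′ : ∀ {p} → IsInfinitePath G p → (∀ k → p k ∈ B.set) → Follows i f p →
            WinsPlay G i p
    wins′ path inB follows =
      let m , pm∈D = B.reach path (B.within ∘ inB)
            (λ k _ pk∉D owned →
              trans (follows k owned) (splice-no (_∈? D.set) D.choice B.choice pk∉D))
            (inB 0)
      in D.wins-once-inside path (B.within ∘ inB)
           (λ k pk∈D owned →
             trans (follows k owned) (splice-yes (_∈? D.set) D.choice B.choice pk∈D))
           m pm∈D

  -- The opponent can leave `E` only towards `D`, so `D` takes precedence in the choice. A play that
  -- ever enters `D` remains there; otherwise it stays in `E` throughout.
  dominion-∪ : ∀ {i X} (D : Dominion i X) → Dominion i (X ∩ ∁ (Dominion.set D)) →
               Dominion i X
  dominion-∪ {i} {X} D E = record
    { set    = D.set ∪ E.set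
    ; choice = f
    ; within = within′
    ; own    = own′
    ; other  = other′
    ; wins   = wins′
    }
    where
    module D = Dominion D
    module E = Dominion E

    f : Choice
    f = splice (_∈? D.set) D.choice E.choice

    within′ : D.set ∪ E.set ⊆ X
    within′ v∈ = [ D.within , (λ v∈E → proj₁ (─⁻ X D.set (E.within v∈E))) ]′
                   (x∈p∪q⁻ D.set E.set v∈)

    E-unless-D : ∀ {v} → v ∈ D.set ∪ E.set → v ∉ D.set → v ∈ E.set
    E-unless-D v∈ v∉D with x∈p∪q⁻ D.set E.set v∈
    ... | inj₁ v∈D = contradiction v∈D v∉D
    ... | inj₂ v∈E = v∈E

    own′ : ∀ {v} → v ∈ D.set ∪ E.set → 𝒫 v ≡ i → at f v ∈ D.set ∪ E.set
    own′ {v} v∈ owned with v ∈? D.set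
    ... | yes v∈D = x∈p∪q⁺ (inj₁ (D.own v∈D owned))
    ... | no  v∉D = x∈p∪q⁺ (inj₂ (E.own (E-unless-D v∈ v∉D) owned))

    other′ : ∀ {v u} → v ∈ D.set ∪ E.set → 𝒫 v ≡ opp i → v ⟶ u → u ∈ X →
             u ∈ D.set ∪ E.set
    other′ {v} {u} v∈ owned v⟶u u∈X with v ∈? D.set | u ∈? D.set
    ... | _       | yes u∈D = x∈p∪q⁺ (inj₁ u∈D)
    ... | yes v∈D | no _    = x∈p∪q⁺ (inj₁ (D.other v∈D owned v⟶u u∈X))
    ... | no  v∉D | no u∉D  =
      x∈p∪q⁺ (inj₂ (E.other (E-unless-D v∈ v∉D) owned v⟶u (─⁺ u∈X u∉D)))

    wins′ : ∀ {p} → IsInfinitePath G p → (∀ k → p k ∈ D.set ∪ E.set) →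
            Follows i f p → WinsPlay G i p
    -- Whether the play ever enters `D` is undecidable, hence the appeal to stability.
    wins′ {p} path inside follows = WinsPlay-stable i λ ¬wins →
      let never-D : ∀ m → p m ∉ D.set
          never-D m pm∈D = ¬wins (D.wins-once-inside path (within′ ∘ inside)
            (λ k pk∈D owned →
              trans (follows k owned) (splice-yes (_∈? D.set) D.choice E.choice pk∈D))
            m pm∈D)
      in ¬wins (E.wins path (λ k → E-unless-D (inside k) (never-D k))
           (λ k owned → trans (follows k owned)
             (splice-no (_∈? D.set) D.choice E.choice (never-D k))))

  record Solution (X : Subset size) : Set where
    field
      dominion : ∀ i → Dominion i X
      covers   : ∀ {v} → v ∈ X → ∃ λ i → v ∈ Dominion.set (dominion i)

  solution : ∀ {X} i (D : Dominion i X) (E : Dominion (opp i) X) →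
             (∀ {v} → v ∈ X → v ∈ Dominion.set D ⊎ v ∈ Dominion.set E) → Solution X
  solution ◇ D E cover = record
    { dominion = λ { ◇ → D ; □ → E }
    ; covers   = [ (◇ ,_) , (□ ,_) ]′ ∘ cover
    }
  solution □ D E cover = record
    { dominion = λ { ◇ → E ; □ → D }
    ; covers   = [ (□ ,_) , (◇ ,_) ]′ ∘ cover
    }

  lowest-vertex : ∀ {X v} → v ∈ X → ∃ λ a → a ∈ X × (∀ {u} → u ∈ X → Ω a ≤ Ω u)
  lowest-vertex {X} {v} = search (<-wellFounded (Ω v))
    where
    search : ∀ {v} → Acc _<_ (Ω v) → v ∈ X → ∃ λ a → a ∈ X × (∀ {u} → u ∈ X → Ω a ≤ Ω u)
    search {v} (acc rec) v∈X with any? (λ u → (u ∈? X) ×-dec (Ω u <? Ω v))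
    ... | yes (u , u∈X , Ωu<Ωv) = search (rec Ωu<Ωv) u∈X
    ... | no  none = v , v∈X , λ {u} u∈X → ≮⇒≥ λ Ωu<Ωv → none (u , u∈X , Ωu<Ωv)

  -- A play visiting a infinitely often has the lowest priority Ω a, favouring i;
  -- any other play ends up outside the attractor of a, inside D.
  whole-dominion : ∀ {i X a} → Subgame X → Favours i (Ω a) → (∀ {u} → u ∈ X → Ω a ≤ Ω u) →
                   (B : Attractor i X ⁅ a ⁆) (D : Dominion i (X ∩ ∁ (Attractor.set B))) →
                   (∀ {v} → v ∈ X ∩ ∁ (Attractor.set B) → v ∈ Dominion.set D) →
                   Σ (Dominion i X) λ E → X ⊆ Dominion.set E
  whole-dominion {i} {X} {a} sub fav lowest B D all-D = record
    { set    = X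
    ; choice = f
    ; within = id
    ; own    = own′
    ; other  = λ _ _ _ u∈X → u∈X
    ; wins   = wins′
    } , id
    where
    module B = Attractor B
    module D = Dominion D

    a∈X : a ∈ X
    a∈X = B.within (B.target (x∈⁅x⁆ a))

    f₁ f : Choice
    f₁ = splice (_∈? B.set) B.choice D.choice
    -- `Forcing` leaves the choice on its target open, so `a` is sent to some successor in `X`.
    f  = redirect (proj₁ (proj₂ (sub a∈X))) f₁

    f-a : at f a ≡ proj₁ (sub a∈X)
    f-a = redirect-here (proj₁ (proj₂ (sub a∈X))) f₁

    f-B : ∀ {v} → v ∈ B.set → v ≢ a → at f v ≡ at B.choice v
    f-B v∈B v≢a = trans (redirect-there (proj₁ (proj₂ (sub a∈X))) f₁ v≢a)
                        (splice-yes (_∈? B.set) B.choice D.choice v∈B)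

    f-D : ∀ {v} → v ∉ B.set → at f v ≡ at D.choice v
    f-D v∉B = trans (redirect-there (proj₁ (proj₂ (sub a∈X))) f₁
                      λ { refl → v∉B (B.target (x∈⁅x⁆ a)) })
                    (splice-no (_∈? B.set) B.choice D.choice v∉B)

    ∉⁅a⁆ : ∀ {v} → v ≢ a → v ∉ ⁅ a ⁆
    ∉⁅a⁆ v≢a = v≢a ∘ x∈⁅y⁆⇒x≡y a

    own′ : ∀ {v} → v ∈ X → 𝒫 v ≡ i → at f v ∈ X
    own′ {v} v∈X owned = by (v ≟ a) (v ∈? B.set)
      where
      by : Dec (v ≡ a) → Dec (v ∈ B.set) → at f v ∈ X
      by (yes v≡a) _ = subst (_∈ X) (sym (trans (cong (at f) v≡a) f-a)) (proj₂ (proj₂ (sub a∈X)))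
      by (no v≢a) (yes v∈B) =
        subst (_∈ X) (sym (f-B v∈B v≢a)) (B.within (B.own v∈B (∉⁅a⁆ v≢a) owned))
      by (no v≢a) (no v∉B) =
        subst (_∈ X) (sym (f-D v∉B))
          (proj₁ (─⁻ X B.set (D.within (D.own (all-D (─⁺ v∈X v∉B)) owned))))

    wins′ : ∀ {p} → IsInfinitePath G p → (∀ k → p k ∈ X) → Follows i f p → WinsPlay G i p
    wins′ {p} path inX follows = WinsPlay-stable i λ ¬wins →
      let infinitely : Inf λ k → p k ≡ a
          infinitely (m , never) = ¬wins (WinsPlay-shift i m
            (wins-avoiding (λ k → path (k + m)) (λ k → inX (k + m)) (λ k → follows (k + m))
              (λ k → never (k + m) (m≤n+m m k))))
      in ¬wins (recurring-minimum-wins i fav (lowest ∘ inX) (Inf-map (cong Ω) infinitely))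
      where
      wins-avoiding : ∀ {q} → IsInfinitePath G q → (∀ k → q k ∈ X) → Follows i f q →
                      (∀ k → q k ≢ a) → WinsPlay G i q
      wins-avoiding {q} path inX follows never =
        D.wins path (λ k → all-D (─⁺ (inX k) (∉B k)))
          (λ k owned → trans (follows k owned) (f-D (∉B k)))
        where
        ∉B : ∀ k → q k ∉ B.set
        ∉B k qk∈B =
          let m , qm∈⁅a⁆ = B.reach {shift k q} (λ j → path (j + k)) (λ j → inX (j + k))
                (λ j qj∈B _ owned → trans (follows (j + k) owned) (f-B qj∈B (never (j + k))))
                qk∈B
          in never (m + k) (x∈⁅y⁆⇒x≡y a qm∈⁅a⁆)

  ─-⊂ : ∀ X (B : Subset size) {v} → v ∈ X → v ∈ B → X ∩ ∁ B ⊂ X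
  ─-⊂ X B {v} v∈X v∈B = p∩q⊆p X (∁ B) , v , v∈X , λ v∈ → proj₂ (─⁻ X B v∈) v∈B

  covers-either : ∀ {X} (S : Solution X) i {v} → v ∈ X →
                  v ∈ Dominion.set (Solution.dominion S i) ⊎
                  v ∈ Dominion.set (Solution.dominion S (opp i))
  covers-either S i v∈X with Solution.covers S v∈X
  ... | j , v∈j with j ≟ᴾ i
  ...   | yes refl = inj₁ v∈j
  ...   | no  j≢i with refl ← ≢⇒≡opp j≢i = inj₂ v∈j

  module _ {i X} (D : Dominion (opp i) X) (C : Attractor (opp i) X (Dominion.set D))
           (S : Solution (X ∩ ∁ (Attractor.set C))) where

    private
      module C = Attractor C
      module S = Solution S

    -- Player `i` keeps what `S` gives it, since outside `C` its opponent has no move into `C`; the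
    -- part of `opp i` can be left only towards `C`, which `opp i` wins too.
    solution-beyond : Solution X
    solution-beyond = solution i (dominion-lift refl C (S.dominion i))
      (dominion-∪ (dominion-attractor D C) (S.dominion (opp i))) cover
      where
      cover : ∀ {v} → v ∈ X → v ∈ Dominion.set (S.dominion i) ⊎
              v ∈ C.set ∪ Dominion.set (S.dominion (opp i))
      cover {v} v∈X with v ∈? C.set
      ... | yes v∈C = inj₂ (x∈p∪q⁺ (inj₁ v∈C))
      ... | no  v∉C with covers-either S i (─⁺ v∈X v∉C)
      ...   | inj₁ v∈i = inj₁ v∈i
      ...   | inj₂ v∈j = inj₂ (x∈p∪q⁺ (inj₂ v∈j))

  -- Zielonka's recursion.
  module _ {X} (rec : ∀ {Y} → Y ⊂ X → Subgame Y → Solution Y) (sub : Subgame X)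
           {a i} (a∈X : a ∈ X) (lowest : ∀ {u} → u ∈ X → Ω a ≤ Ω u) (fav : Favours i (Ω a))
           where

    -- If the opponent wins nothing outside the attractor of the lowest vertex, `i` wins all of `X`.
    -- Otherwise the opponent's part is a dominion of `X` itself, and removing its attractor leaves
    -- a strictly smaller subgame.
    solve-around : (A : Attractor i X ⁅ a ⁆) → Solution (X ∩ ∁ (Attractor.set A)) → Solution X
    solve-around A S with nonempty? (Dominion.set (Solution.dominion S (opp i)))
    ... | no empty =
      let E , X⊆E = whole-dominion sub fav lowest A (Solution.dominion S i)
            λ v∈ → [ id , (λ v∈j → contradiction (_ , v∈j) empty) ]′ (covers-either S i v∈)
      in solution i E (∅-dominion (opp i) X) (inj₁ ∘ X⊆E)
    ... | yes (u , u∈D) = solution-beyond D C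
            (rec (─-⊂ X C.set (Dominion.within D u∈D) (C.target u∈D))
              (attractor-complement sub C))
      where
      D : Dominion (opp i) X
      D = dominion-lift (opp-involutive i) A (Solution.dominion S (opp i))

      C : Attractor (opp i) X (Dominion.set D)
      C = attractor (opp i) X (Dominion.set D) (Dominion.within D)
      module C = Attractor C

    solve-step : Solution X
    solve-step = solve-around A
      (rec (─-⊂ X (Attractor.set A) a∈X (Attractor.target A (x∈⁅x⁆ a)))
        (attractor-complement sub A))
      where
      A : Attractor i X ⁅ a ⁆
      A = attractor i X ⁅ a ⁆ λ v∈ → subst (_∈ X) (sym (x∈⁅y⁆⇒x≡y a v∈)) a∈X

  solve : ∀ {X} → Acc _⊂_ X → Subgame X → Solution X
  solve {X} (acc rec) sub with nonempty? X
  ... | no empty = solution ◇ (∅-dominion ◇ X) (∅-dominion □ X)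
                     λ v∈X → contradiction (_ , v∈X) empty
  ... | yes (_ , v∈X) =
    let a , a∈X , lowest = lowest-vertex v∈X
    in solve-step (λ Y⊂X → solve (rec Y⊂X)) sub a∈X lowest (proj₂ (favoured (Ω a)))

  abstract
    determinacy : Solution ⊤
    determinacy = solve (⊂-wellFounded ⊤) λ {v} _ → let u , v⟶u = total v in u , v⟶u , ∈⊤

  -- Memoryless strategies and choice functions

  -- Undefined moves are filled in by `total`. This commits the player further than `σ`, so
  -- following the choice implies being allowed by `σ`, but not conversely.
  choice-of : ∀ {i} → MemorylessStrategy G i → Choice
  choice-of σ .at v = fromMaybe (proj₁ (total v)) (MemorylessStrategy.move σ v)
  choice-of σ .edge v with MemorylessStrategy.move σ v in eq
  ... | just u  = proj₂ (MemorylessStrategy.valid σ eq)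
  ... | nothing = proj₂ (total v)

  Follows⇒AllowsMemoryless : ∀ {i p} (σ : MemorylessStrategy G i) →
                             Follows i (choice-of σ) p → AllowsMemoryless G σ p
  Follows⇒AllowsMemoryless {p = p} σ follows j eq =
    trans (follows j (proj₁ (MemorylessStrategy.valid σ eq)))
          (cong (fromMaybe (proj₁ (total (p j)))) eq)

  strategy-of : ∀ i → Choice → MemorylessStrategy G i
  strategy-of i f = record { move = move ; valid = valid }
    where
    move : V → Maybe V
    move v with 𝒫 v ≟ᴾ i
    ... | yes _ = just (at f v)
    ... | no  _ = nothing

    valid : ∀ {v u} → move v ≡ just u → 𝒫 v ≡ i × v ⟶ u
    valid {v} eq with 𝒫 v ≟ᴾ i | eq
    ... | yes owned | refl = owned , edge f v

  AllowsMemoryless⇒Follows : ∀ {i p} f → AllowsMemoryless G (strategy-of i f) p →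
                             Follows i f p
  AllowsMemoryless⇒Follows {i} {p} f allowed k owned = allowed k moves
    where
    moves : MemorylessStrategy.move (strategy-of i f) (p k) ≡ just (at f (p k))
    moves with 𝒫 (p k) ≟ᴾ i
    ... | yes _     = refl
    ... | no ¬owned = contradiction owned ¬owned

  -- The move depends on the last vertex alone; the `linked?` test is there because a strategy may
  -- be defined on finite paths only.
  history-strategy : ∀ {i X} → Dominion i X → Strategy G i
  history-strategy {i} D = record { move = move ; valid = valid }
    where
    open Dominion D

    move : List V → Maybe V
    move h with last h
    ... | nothing = nothing
    ... | just v with linked? _⟶?_ h | 𝒫 v ≟ᴾ i
    ...   | yes _ | yes _ = just (at choice v)
    ...   | yes _ | no  _ = nothing
    ...   | no  _ | _     = nothing

    valid : ∀ {h u} → move h ≡ just u →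
            Linked _⟶_ h × ∃ λ x → last h ≡ just x × 𝒫 x ≡ i × x ⟶ u
    valid {h} eq with last h
    ... | just v with linked? _⟶?_ h | 𝒫 v ≟ᴾ i | eq
    ...   | yes path | yes owned | refl = path , v , refl , owned , edge choice v

  last-applyUpTo : ∀ {A : Set} (p : ℕ → A) j → last (applyUpTo p (suc j)) ≡ just (p j)
  last-applyUpTo p zero    = refl
  last-applyUpTo p (suc j) = last-applyUpTo (p ∘ suc) j

  dominion-won : ∀ {i v} (D : Dominion i ⊤) → v ∈ Dominion.set D → WonBy G i v
  dominion-won {i} {v} D v∈D = history-strategy D , winning
    where
    open Dominion D

    moves : ∀ {p} → IsInfinitePath G p → ∀ k → 𝒫 (p k) ≡ i →
            Strategy.move (history-strategy D) (applyUpTo p (suc k)) ≡ just (at choice (p k))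
    moves {p} path k owned rewrite last-applyUpTo p k
      with linked? _⟶?_ (applyUpTo p (suc k)) | 𝒫 (p k) ≟ᴾ i
    ... | yes _ | yes _     = refl
    ... | yes _ | no ¬owned = contradiction owned ¬owned
    ... | no ¬path | _      = contradiction (applyUpTo⁺₂ p (suc k) path) ¬path

    winning : IsWinningFrom G v (history-strategy D)
    winning p (refl , path) allowed =
      wins-once-inside path (λ _ → ∈⊤) (λ k _ owned → allowed k (moves path k owned)) 0 v∈D

  -- Plays resolved by a pair of choice functions

  versus : Player → Choice → Choice → Choice
  versus i = splice (λ v → 𝒫 v ≟ᴾ i)

  run : Choice → V → ℕ → V
  run f v = fold v (at f)

  run-path : ∀ f v → IsInfinitePath G (run f v)
  run-path f v k = edge f (run f v k)

  versus-own : ∀ i f g v → Follows i f (run (versus i f g) v)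
  versus-own i f g v k = splice-yes (λ v → 𝒫 v ≟ᴾ i) f g

  versus-other : ∀ {i j} → i ≢ j → ∀ f g v → Follows j g (run (versus i f g) v)
  versus-other {i} i≢j f g v k owned =
    splice-no (λ v → 𝒫 v ≟ᴾ i) f g λ owned′ → i≢j (trans (sym owned′) owned)

  -- Concatenation of segments

  -- `TransClosure` makes segments nonempty, so every position has a next edge and `path` consumes
  -- one edge per step. Each segment is finite and hence eventually left, so `segment-of` is
  -- unbounded.
  module Concatenation {A : Set} {T : ℕ → Rel A 0ℓ} {s : ℕ → A}
                       (segment : ∀ m → TransClosure (T m) (s m) (s (suc m))) where

    record Position : Set where
      constructor position
      field
        index  : ℕ
        {here} : A
        rest   : TransClosure (T index) here (s (suc index))
    open Position

    next : Position → Position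
    next (position m [ _ ])      = position (suc m) (segment (suc m))
    next (position m (_ ∷ rest)) = position m rest

    positions : ℕ → Position
    positions = fold (position 0 (segment 0)) next

    path : ℕ → A
    path = here ∘ positions

    segment-of : ℕ → ℕ
    segment-of = index ∘ positions

    path-edge : ∀ j → T (segment-of j) (path j) (path (suc j))
    path-edge j with positions j
    ... | position _ [ e ]   = e
    ... | position _ (e ∷ _) = e

    segment-of-slow : Slow segment-of
    segment-of-slow = record { step = step ; unbounded = unbounded }
      where
      step : ∀ j → segment-of (suc j) ≡ segment-of j ⊎ segment-of (suc j) ≡ suc (segment-of j)
      step j with positions j
      ... | position _ [ _ ]   = inj₂ refl
      ... | position _ (_ ∷ _) = inj₁ refl

      leaves : ∀ j {m x} (r : TransClosure (T m) x (s (suc m))) → positions j ≡ position m r →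
               ∃ λ k → segment-of k ≡ suc m
      leaves j [ _ ]      eq = suc j , cong (index ∘ next) eq
      leaves j (_ ∷ rest) eq = leaves (suc j) rest (cong next eq)

      unbounded : ∀ n → ∃ λ j → n ≤ segment-of j
      unbounded zero    = 0 , z≤n
      unbounded (suc n) =
        let j , n≤ = unbounded n
            k , eq = leaves j (rest (positions j)) refl
        in k , ≤-trans (s≤s n≤) (≤-reflexive (sym eq))

  -- Mixed classes

  module Mixed {R : Rel V 0ℓ} (bisim : IsGovernedStutteringBisimulation G R)
               (R? : ∀ v w → Dec (R v w)) (S : Solution ⊤) where

    open IsGovernedStutteringBisimulation bisim
    private module ≈ = IsEquivalence isEquivalence
    module W (i : Player) = Dominion (Solution.dominion S i)

    record Move (i : Player) (d : ℕ) (v u : V) : Set where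
      field
        label  : Ω v ≡ d
        inside : v ∈ W.set i
        moves  : v ⟶ u
        obeys  : 𝒫 v ≡ i → u ≡ at (W.choice i) v

    -- Every vertex but the last carries the priority of the start; the last one already begins the
    -- next segment.
    Segment : Player → Rel V 0ℓ
    Segment i v = TransClosure (Move i (Ω v)) v

    Move-target : ∀ {i d v u} → Move i d v u → u ∈ W.set i
    Move-target {i} {v = v} m with 𝒫 v ≟ᴾ i
    ... | yes owned = subst (_∈ W.set i) (sym (Move.obeys m owned)) (W.own i (Move.inside m) owned)
    ... | no ¬owned = W.other i (Move.inside m) (≢⇒≡opp ¬owned) (Move.moves m) ∈⊤

    moves-target : ∀ {i d v u} → TransClosure (Move i d) v u → u ∈ W.set i
    moves-target [ m ]    = Move-target m
    moves-target (_ ∷ ms) = moves-target ms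

    inside-always : ∀ {i p} → p 0 ∈ W.set i → IsInfinitePath G p → Follows i (W.choice i) p →
                    ∀ k → p k ∈ W.set i
    inside-always {i} p0∈W path follows =
      W.stays i path (λ _ → ∈⊤) (λ k _ → follows k) p0∈W

    trace : ∀ {T : Rel V 0ℓ} (p : ℕ → V) m → (∀ k → k ≤ m → T (p k) (p (suc k))) →
            TransClosure T (p 0) (p (suc m))
    trace p zero    edges = [ edges 0 z≤n ]
    trace p (suc m) edges =
      trace p m (λ k k≤m → edges k (≤-trans k≤m (n≤1+n m))) ∷ʳ edges (suc m) ≤-refl

    segment : ∀ {i p} → p 0 ∈ W.set i → IsInfinitePath G p → Follows i (W.choice i) p →
              ∀ m → (∀ k → k ≤ m → R (p 0) (p k)) → Segment i (p 0) (p (suc m))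
    segment {i} {p} p0∈W path follows m related = trace p m λ k k≤m → record
      { label  = sym (priority (related k k≤m))
      ; inside = inside-always p0∈W path follows k
      ; moves  = path k
      ; obeys  = follows k
      }

    -- One play tied to both the winning choice of `i` and an arbitrary strategy of `j`, so that the
    -- guarantees of both hold on it.
    module Duel {i j} (i≢j : i ≢ j) {v} (v∈W : v ∈ W.set i) (ρ : MemorylessStrategy G j) where

      play : ℕ → V
      play = run (versus i (W.choice i) (choice-of ρ)) v

      play-path : IsInfinitePath G play
      play-path = run-path (versus i (W.choice i) (choice-of ρ)) v

      play-obeys : Follows i (W.choice i) play
      play-obeys = versus-own i (W.choice i) (choice-of ρ) v

      play-allowed : AllowsMemoryless G ρ play
      play-allowed =
        Follows⇒AllowsMemoryless ρ (versus-other i≢j (W.choice i) (choice-of ρ) v)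

    Forces : Player → V → V → Set
    Forces i v c = _↦⟨_,_⟩_ G v i (R v) (R c)

    force : ∀ {i j v c} → i ≢ j → v ∈ W.set i → ¬ R v c →
            Forces j v c → ∃ λ v′ → Segment i v v′ × R c v′
    force {i} {v = v} {c} i≢j v∈W v≉c (ρ , forced) =
      first (forced play (refl , play-path) play-allowed)
      where
      open Duel i≢j v∈W ρ

      first : (∃ λ n → R c (play n) × (∀ k → k < n → R v (play k))) →
              ∃ λ v′ → Segment i v v′ × R c v′
      -- Reaching the class at once would put `v` in it, so the segment has at least one move.
      first (zero  , c≈v , _)      = contradiction (≈.sym c≈v) v≉c
      first (suc m , c≈  , before) =
        _ , segment v∈W play-path play-obeys m (λ k k≤m → before k (s≤s k≤m)) , c≈

    -- On the play resolving both strategies, each target is the first class entered after that of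
    -- `v`: an earlier arrival at one would contradict the other's promise to stay in the class of
    -- `v` until its own arrival.
    force-agree : ∀ {i j v c d} → i ≢ j → ¬ R v c → ¬ R v d →
                  Forces i v c → Forces j v d → R c d
    force-agree {i} {j} {v} {c} {d} i≢j v≉c v≉d (σ , forced-c) (ρ , forced-d) =
      agree (forced-c p (refl , path) (Follows⇒AllowsMemoryless σ (versus-own i f g v)))
            (forced-d p (refl , path) (Follows⇒AllowsMemoryless ρ (versus-other i≢j f g v)))
      where
      f g : Choice
      f = choice-of σ
      g = choice-of ρ

      p : ℕ → V
      p = run (versus i f g) v

      path : IsInfinitePath G p
      path = run-path (versus i f g) v

      agree : (∃ λ n → R c (p n) × (∀ k → k < n → R v (p k))) →
              (∃ λ n → R d (p n) × (∀ k → k < n → R v (p k))) → R c d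
      agree (m , c≈ , before-m) (n , d≈ , before-n) with <-cmp m n
      ... | tri< m<n _ _  = contradiction (≈.trans (before-n m m<n) (≈.sym c≈)) v≉c
      ... | tri≈ _ refl _ = ≈.trans c≈ (≈.sym d≈)
      ... | tri> _ _ n<m  = contradiction (≈.trans (before-m n n<m) (≈.sym d≈)) v≉d

    -- The `step` condition transfers the move at `v′` to `w`, giving the power to reach the new
    -- class to the owner of `v′`.
    exit : ∀ {v v′ w u} → R v v′ → v′ ⟶ u → R v w → ¬ R v u →
           Forces (𝒫 v′) w u
    exit v≈v′ v′⟶u v≈w v≉u =
      step (≈.trans (≈.sym v≈v′) v≈w) _
        (λ same → v≉u (≈.trans v≈v′ (proj₁ same ≈.refl)))
        (_ , v′⟶u , ≈.refl)

    favoured-stays-wins : ∀ {i v p} → Favours i (Ω v) → (∀ k → R v (p k)) → WinsPlay G i p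
    favoured-stays-wins {i} fav stays = recurring-minimum-wins i fav
      (λ k → ≤-reflexive (priority (stays k)))
      (λ { (m , never) → never m ≤-refl (sym (priority (stays m))) })

    module _ {i v w} (fav : Favours i (Ω v)) (v∈W : v ∈ W.set i) (w∈W : w ∈ W.set (opp i))
             (v≈w : R v w) where

      private
        j : Player
        j = opp i

        -- A play that stays is won by `i`, whom the sole priority of the class favours, yet this
        -- one follows a winning choice of `j`.
        leaves : ∀ {p} → p 0 ≡ w → IsInfinitePath G p → Follows j (W.choice j) p →
                 ¬ (∀ k → R v (p k))
        leaves refl path follows stays = not-both-win i (favoured-stays-wins fav stays)
          (W.wins j path (inside-always w∈W path follows) follows)

        -- By `diverge`, `i` could equally stay from `w`; the duel there against the winning choice
        -- of `j` contradicts `leaves`.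
        cannot-stay : ¬ (_↦⟨_,_⟩) G v i (R v)
        cannot-stay stay with ρ , forced ← diverge v≈w i stay =
          leaves refl play-path play-obeys
            (λ k → ≈.trans v≈w (forced play (refl , play-path) play-allowed k))
          where open Duel (≢opp i ∘ sym) w∈W ρ

        record Exit (k : Player) (x : V) : Set where
          field
            {from to} : V
            segment-to : Segment k x to
            related    : R v from
            unrelated  : ¬ R v to
            exits      : from ⟶ to

        exit-of : ∀ {k p} → R v (p 0) → p 0 ∈ W.set k → IsInfinitePath G p →
                  Follows k (W.choice k) p → ∀ n → ¬ R v (p n) → Exit k (p 0)
        exit-of {p = p} v≈p0 p0∈W path follows n v≉pn =
          let m , before , after = first-exit (R? v ∘ p) v≈p0 n v≉pn
          in record
            { segment-to = segment p0∈W path follows m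
                             (λ k k≤m → ≈.trans (≈.sym v≈p0) (before k k≤m))
            ; related    = before m ≤-refl
            ; unrelated  = after
            ; exits      = path m
            }

        stable : ∀ {x} → ¬ ¬ R v x → R v x
        stable = decidable-stable (R? v _)

        exit-w : ¬ ¬ Exit j w
        exit-w none = leaves refl (run-path f w) (λ _ _ → refl)
          (λ k → stable (none ∘ exit-of v≈w w∈W (run-path f w) (λ _ _ → refl) k))
          where f = W.choice j

        -- Unlike from `w`, only some play has to leave: if none did, the winning choice would
        -- itself be a strategy of `i` for staying.
        exit-v : ¬ ¬ Exit i v
        exit-v none = cannot-stay (strategy-of i f , λ { p (refl , path) allowed k →
            stable (none ∘ exit-of ≈.refl v∈W path (AllowsMemoryless⇒Follows f allowed) k) })
          where f = W.choice i

      -- If a player exits by the own winning strategy on one play, step lets that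
      -- player force the same class on the other play. Otherwise i exits on the
      -- play from w and j on the play from v; then each can force the class thus
      -- entered from v, and pitting the two forcing strategies against each
      -- other shows that both exits enter the same class.
      advance-favoured : ¬ ¬ ∃ λ v′ → ∃ λ w′ → Segment i v v′ × Segment j w w′ × R v′ w′
      advance-favoured none = exit-w λ ew → exit-v λ ev →
        by-owner ew ev (𝒫 (Exit.from ew) ≟ᴾ i) (𝒫 (Exit.from ev) ≟ᴾ i)
        where
        by-owner : (ew : Exit j w) (ev : Exit i v) → Dec (𝒫 (Exit.from ew) ≡ i) →
                   Dec (𝒫 (Exit.from ev) ≡ i) → ⊥
        by-owner ew ev (no ¬i) _ =
          let v′ , seg , c≈v′ = force (≢opp i) v∈W ew.unrelated
                (subst (λ k → Forces k v ew.to) (≢⇒≡opp ¬i)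
                  (exit ew.related ew.exits ≈.refl ew.unrelated))
          in none (v′ , ew.to , seg , ew.segment-to , ≈.sym c≈v′)
          where module ew = Exit ew
        by-owner ew ev (yes _) (yes ev-i) =
          let w′ , seg , c≈w′ = force (≢opp i ∘ sym) w∈W (ev.unrelated ∘ ≈.trans v≈w)
                (subst (λ k → Forces k w ev.to) ev-i
                  (exit ev.related ev.exits v≈w ev.unrelated))
          in none (ev.to , w′ , ev.segment-to , seg , c≈w′)
          where module ev = Exit ev
        by-owner ew ev (yes ew-i) (no ¬i) =
          none (ev.to , ew.to , ev.segment-to , ew.segment-to ,
            ≈.sym (force-agree (λ e → ¬i (trans (sym e) ew-i)) ew.unrelated ev.unrelated
              (exit ew.related ew.exits ≈.refl ew.unrelated)
              (exit ev.related ev.exits ≈.refl ev.unrelated)))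
          where
          module ew = Exit ew
          module ev = Exit ev

    -- Iterating the advance of mixed pairs

    Advance : V → V → Set
    Advance v w = ∃ λ v′ → ∃ λ w′ → Segment ◇ v v′ × Segment □ w w′ × R v′ w′

    advance : ∀ {v w} → v ∈ W.set ◇ → w ∈ W.set □ → R v w → ¬ ¬ Advance v w
    advance {v} {w} v∈W w∈W v≈w none with favoured (Ω v)
    ... | ◇ , fav = advance-favoured fav v∈W w∈W v≈w none
    ... | □ , fav = advance-favoured (subst (Favours □) (priority v≈w) fav) w∈W v∈W (≈.sym v≈w)
      λ { (w′ , v′ , seg-w , seg-v , w′≈v′) → none (v′ , w′ , seg-v , seg-w , ≈.sym w′≈v′) }

    record MixedPair : Set where
      constructor mixed
      field
        {left right} : V
        left∈   : left ∈ W.set ◇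
        right∈  : right ∈ W.set □
        related : R left right

    module _ (go : ∀ v w → v ∈ W.set ◇ → w ∈ W.set □ → R v w → Advance v w)
             (start : MixedPair) where
      open MixedPair

      private
        next : MixedPair → MixedPair
        next (mixed l r l≈r) =
          let _ , _ , seg-l , seg-r , l′≈r′ = go _ _ l r l≈r
          in mixed (moves-target seg-l) (moves-target seg-r) l′≈r′

        pairs : ℕ → MixedPair
        pairs = fold start next

        segmentˡ : ∀ m → Segment ◇ (left (pairs m)) (left (pairs (suc m)))
        segmentˡ m with pairs m
        ... | mixed l r l≈r = let _ , _ , seg-l , _ = go _ _ l r l≈r in seg-l

        segmentʳ : ∀ m → Segment □ (right (pairs m)) (right (pairs (suc m)))
        segmentʳ m with pairs m
        ... | mixed l r l≈r = let _ , _ , _ , seg-r , _ = go _ _ l r l≈r in seg-r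

        -- The starts `s` need not form a path, but they show the priorities of the concatenated
        -- play up to stuttering, and `i` wins that play.
        concatenation-wins : ∀ i (s : ℕ → V) → (∀ m → Segment i (s m) (s (suc m))) →
                             WinsPlay G i s
        concatenation-wins i s segments =
          WinsPlay-slow segment-of-slow {path} {s} (Move.label ∘ path-edge) i
            (W.wins i (Move.moves ∘ path-edge) (Move.inside ∘ path-edge) (Move.obeys ∘ path-edge))
          where open Concatenation segments

      absurd : ⊥
      absurd = not-both-win ◇
        (WinsPlay-slow slow-id (priority ∘ related ∘ pairs) ◇
          (concatenation-wins ◇ (left ∘ pairs) segmentˡ))
        (concatenation-wins □ (right ∘ pairs) segmentʳ)

    -- Infinitely many advances are made, yet one fixed for each of the finitely many pairs
    -- generates them all, so the double negations can be collected first.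
    no-mixed-pair : ∀ {v w} → v ∈ W.set ◇ → w ∈ W.set □ → ¬ R v w
    no-mixed-pair v∈W w∈W v≈w =
      ¬¬-Π (λ v → ¬¬-Π λ w → ¬¬-→ λ v∈W → ¬¬-→ λ w∈W → ¬¬-→ (advance v∈W w∈W))
        λ go → absurd go (mixed v∈W w∈W v≈w)

  bisimilar⇒winner-equivalent : ∀ v w → GovernedStutteringBisimilar G v w →
                                WinnerEquivalent G v w
  bisimilar⇒winner-equivalent v w (R , bisim , v≈w) = by (covers ∈⊤) (covers ∈⊤)
    where
    open Solution determinacy
    open IsEquivalence (IsGovernedStutteringBisimulation.isEquivalence bisim)
      renaming (sym to ≈-sym)

    clash : ∀ {v w} → v ∈ Dominion.set (dominion ◇) → w ∈ Dominion.set (dominion □) →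
            ¬ R v w
    clash v∈ w∈ v≈w = ¬¬-Π (λ v → ¬¬-Π λ w → ¬¬-excluded-middle) λ R? →
      Mixed.no-mixed-pair bisim R? determinacy v∈ w∈ v≈w

    by : (∃ λ i → v ∈ Dominion.set (dominion i)) → (∃ λ i → w ∈ Dominion.set (dominion i)) →
         WinnerEquivalent G v w
    by (◇ , v∈) (◇ , w∈) = ◇ , dominion-won (dominion ◇) v∈ , dominion-won (dominion ◇) w∈
    by (□ , v∈) (□ , w∈) = □ , dominion-won (dominion □) v∈ , dominion-won (dominion □) w∈
    by (◇ , v∈) (□ , w∈) = contradiction v≈w (clash v∈ w∈)
    by (□ , v∈) (◇ , w∈) = contradiction (≈-sym v≈w) (clash w∈ v∈)

-- Strictness of the refinement

two-loops : ParityGame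
two-loops = record
  { size  = 2
  ; _⟶_   = _≡_
  ; _⟶?_  = _≟_
  ; total = λ v → v , refl
  -- Priorities 0 and 2: distinct, to violate the priority condition, and even, so that ◇ wins both
  -- loops.
  ; Ω     = λ v → 2 * toℕ v
  ; 𝒫     = λ _ → ◇
  }

even-won-by-◇ : ∀ v → WonBy two-loops ◇ v
even-won-by-◇ v =
  record { move = λ _ → nothing ; valid = λ () } ,
  -- An odd priority never occurs, so 0 bounds its occurrences.
  λ p _ _ k (infinitely , _) → decidable-stable (2 ∣? k) λ 2∤k →
    infinitely (0 , λ j _ Ω≡k → 2∤k (subst (2 ∣_) Ω≡k (m∣m*n (toℕ (p j)))))

theorem28 : ((G : ParityGame) (v w : ParityGame.V G) →
    GovernedStutteringBisimilar G v w → WinnerEquivalent G v w)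
    × (Σ ParityGame λ G → ∃ λ (v : ParityGame.V G) → ∃ λ (w : ParityGame.V G) →
    WinnerEquivalent G v w × ¬ GovernedStutteringBisimilar G v w)
theorem28 =
  bisimilar⇒winner-equivalent ,
  two-loops , zero , suc zero , (◇ , even-won-by-◇ zero , even-won-by-◇ (suc zero)) ,
  λ (R , bisim , v≈w) →
    contradiction (IsGovernedStutteringBisimulation.priority bisim v≈w) λ ()
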